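{- Let $s\ge 1$ and $r_1,\dots,r_s\ge 1$ be integers. Then there exist a constant $k$ (depending only on $r_1,\dots,r_s$) and a sequence of $P_{s+1}$-free families $\mathcal{F}_n\subseteq 2^{[n]}$, each of which is a union of full levels of $2^{[n]}$, such that $$La(n,P_{s+1},K_{r_1,r_2,\dots,r_s})=O\left(n^k\,c(K_{r_1,r_2,\dots,r_s},\mathcal{F}_n)\right).$$
   Context: $[n]=\{1,\dots,n\}$, $2^{[n]}$ is the family of all subsets of $[n]$; the full levels of $2^{[n]}$ are the families $\binom{[n]}{k}$ of all $k$-element subsets of $[n]$. For a finite poset $P$ and a family $\mathcal{F}$ of sets, a subfamily $\mathcal{G}\subseteq\mathcal{F}$ is a copy of $P$ in $\mathcal{F}$ if there is a bijection $\phi:P\to\mathcal{G}$ such that $x\le_Px'$ implies $\phi(x)\subseteq\phi(x')$ (the converse is not required). $c(P,\mathcal{F})$ is the number of copies of $P$ in $\mathcal{F}$; $\mathcal{F}$ is $P$-free if $c(P,\mathcal{F})=0$. $La(n,P,Q)=\max\{c(Q,\mathcal{F}):\mathcal{F}\subseteq 2^{[n]},\ c(P,\mathcal{F})=0\}$. $P_k$ is the chain on $k$ elements. The complete multi-level poset $K_{r_1,\dots,r_s}$ has $\sum_{i=1}^sr_i$ elements $a^i_h$ ($1\le i\le s$, $1\le h\le r_i$) with $a^i_h<a^j_l$ if and only if $i<j$. -}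

module Defs where

open import Data.Fin.Base using (Fin; zero; suc; finToFun; funToFin; combine; remQuot)
import Data.Fin.Base as Fin
import Data.Fin.Properties as Fin
open import Data.Fin.Subset using (Subset; _⊆_; ∣_∣; inside; outside)
import Data.Fin.Subset as Sub
import Data.Fin.Subset.Properties as Sub
open import Data.List.Base using (List; []; _∷_; _++_; map; filter; length)
open import Data.List.Extrema.Nat using (max)
open import Data.List.Membership.Propositional using () renaming (_∈_ to _∈ˡ_)
open import Data.Nat.Base using (ℕ; zero; suc; _+_; _*_; _^_; _≤_)
import Data.Nat.Properties as ℕ
open import Data.Product.Base using (Σ; ∃; ∃-syntax; _×_; _,_; proj₁; proj₂)
open import Data.Product.Properties using (≡-dec)
open import Data.Sum.Base using (_⊎_; inj₁; inj₂)
open import Data.Vec.Base using ([]; _∷_)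
import Data.Vec.Functional as Vector
open import Data.Vec.Properties using () renaming (≡-dec to ≡-decᵛ)
import Data.Bool.Properties as Bool
open import Function.Base using (_∘_)
open import Function.Bundles using (_↔_; _⇔_; Inverse; Equivalence; mk↔ₛ′; mk⇔)
open import Function.Construct.Composition using (_↔-∘_)
open import Function.Construct.Identity using (↔-id)
open import Function.Construct.Symmetry using (↔-sym)
open import Function.Definitions using (Injective)
open import Relation.Binary.Core using (_Preserves_⟶_)
open import Relation.Binary.Definitions using (DecidableEquality)
open import Relation.Binary.Structures using (IsDecPartialOrder; IsStrictPartialOrder)
import Relation.Binary.Construct.StrictToNonStrict as StrictToNonStrict
open import Relation.Binary.PropositionalEquality
  using (_≡_; refl; sym; trans; cong; cong₂; subst; subst₂; isEquivalence; _≗_; resp₂)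
open import Relation.Nullary.Decidable
  using (Dec; map′; _×-dec_; _→-dec_)
open import Relation.Unary using (Decidable)

record FinPoset : Set₁ where
  field
    Carrier           : Set
    _≤ᴾ_              : Carrier → Carrier → Set
    isDecPartialOrder : IsDecPartialOrder _≡_ _≤ᴾ_
    size              : ℕ
    finite            : Carrier ↔ Fin size

  open IsDecPartialOrder isDecPartialOrder public
    using () renaming (_≟_ to _≟ᴾ_; _≤?_ to _≤ᴾ?_)

chain : ℕ → FinPoset
chain k = record
  { Carrier           = Fin k
  ; _≤ᴾ_              = Fin._≤_
  ; isDecPartialOrder = record
      { isPartialOrder = Fin.≤-isPartialOrder
      ; _≟_            = Fin._≟_
      ; _≤?_           = Fin._≤?_
      }
  ; size              = k
  ; finite            = ↔-id _
  }

-- K_{r₁,…,r_s}: the pair (i , h) is the element a^i_h.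
module _ {s : ℕ} (r : Fin s → ℕ) where

  MultiLevel : Set
  MultiLevel = Σ (Fin s) (Fin ∘ r)

  _<ᴷ_ : MultiLevel → MultiLevel → Set
  (i , _) <ᴷ (j , _) = i Fin.< j

  <ᴷ-isStrictPartialOrder : IsStrictPartialOrder _≡_ _<ᴷ_
  <ᴷ-isStrictPartialOrder = record
    { isEquivalence = isEquivalence
    ; irrefl        = λ { refl → ℕ.<-irrefl refl }
    ; trans         = ℕ.<-trans
    ; <-resp-≈      = resp₂ _<ᴷ_
    }

Σ-finite : ∀ {s} (r : Fin s → ℕ) → Σ (Fin s) (Fin ∘ r) ↔ Fin (Vector.foldr _+_ 0 r)
Σ-finite {zero}  r = mk↔ₛ′ (λ ()) (λ ()) (λ ()) (λ ())
Σ-finite {suc s} r = ↔-sym Fin.+↔⊎ ↔-∘ mk↔ₛ′ to from to∘from from∘to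
  where
  module T = Inverse (Σ-finite (r ∘ suc))

  to : Σ (Fin (suc s)) (Fin ∘ r) → Fin (r zero) ⊎ Fin (Vector.foldr _+_ 0 (r ∘ suc))
  to (zero  , h) = inj₁ h
  to (suc i , h) = inj₂ (T.to (i , h))

  up : Σ (Fin s) (Fin ∘ r ∘ suc) → Σ (Fin (suc s)) (Fin ∘ r)
  up (i , h) = suc i , h

  from : Fin (r zero) ⊎ Fin (Vector.foldr _+_ 0 (r ∘ suc)) → Σ (Fin (suc s)) (Fin ∘ r)
  from (inj₁ h) = zero , h
  from (inj₂ k) = up (T.from k)

  to∘from : ∀ x → to (from x) ≡ x
  to∘from (inj₁ h) = refl
  to∘from (inj₂ k) = cong inj₂ (T.strictlyInverseˡ k)

  from∘to : ∀ x → from (to x) ≡ x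
  from∘to (zero  , h) = refl
  from∘to (suc i , h) = cong up (T.strictlyInverseʳ (i , h))

K : ∀ {s} → (Fin s → ℕ) → FinPoset
K r = record
  { Carrier           = MultiLevel r
  ; _≤ᴾ_              = NonStrict._≤_
  ; isDecPartialOrder = record
      { isPartialOrder = NonStrict.isPartialOrder (<ᴷ-isStrictPartialOrder r)
      ; _≟_            = _≟_
      ; _≤?_           = NonStrict.decidable _≟_ (λ x y → proj₁ x Fin.<? proj₁ y)
      }
  ; size              = Vector.foldr _+_ 0 r
  ; finite            = Σ-finite r
  }
  where
  module NonStrict = StrictToNonStrict _≡_ (_<ᴷ_ r)
  _≟_ : DecidableEquality (MultiLevel r)
  _≟_ = ≡-dec Fin._≟_ Fin._≟_

code : ∀ n → Subset n ↔ Fin (2 ^ n)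
code zero    = mk↔ₛ′ (λ _ → zero) (λ _ → []) (λ { zero → refl }) (λ { [] → refl })
code (suc n) = mk↔ₛ′ to from to∘from from∘to
  where
  module B = Inverse Fin.2↔Bool
  module C = Inverse (code n)

  to : Subset (suc n) → Fin (2 * 2 ^ n)
  to (b ∷ A) = combine (B.from b) (C.to A)

  glue : Fin 2 × Fin (2 ^ n) → Subset (suc n)
  glue (i , j) = B.to i ∷ C.from j

  from : Fin (2 * 2 ^ n) → Subset (suc n)
  from k = glue (remQuot {2} (2 ^ n) k)

  to∘from : ∀ k → to (from k) ≡ k
  to∘from k = trans
    (cong₂ combine (B.strictlyInverseʳ (proj₁ (remQuot {2} (2 ^ n) k)))
                   (C.strictlyInverseˡ (proj₂ (remQuot {2} (2 ^ n) k))))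
    (Fin.combine-remQuot {2} (2 ^ n) k)

  from∘to : ∀ A → from (to A) ≡ A
  from∘to (b ∷ A) = trans
    (cong glue (Fin.remQuot-combine (B.from b) (C.to A)))
    (cong₂ _∷_ (B.strictlyInverseˡ b) (C.strictlyInverseʳ A))

-- A family 𝓕 ⊆ 2^[n] is a Boolean vector indexed by the 2^n subsets of [n]
-- (enumerated by `code`), so distinct values of `Family n` are distinct families.
record Family (n : ℕ) : Set where
  constructor family
  field
    members : Subset (2 ^ n)

open Family public

infix 4 _∈ᶠ_ _∈ᶠ?_ _⊆ᶠ_ _⊆ᶠ?_

_∈ᶠ_ : ∀ {n} → Subset n → Family n → Set
A ∈ᶠ 𝓕 = Inverse.to (code _) A Sub.∈ members 𝓕

_∈ᶠ?_ : ∀ {n} (A : Subset n) (𝓕 : Family n) → Dec (A ∈ᶠ 𝓕)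
A ∈ᶠ? 𝓕 = Inverse.to (code _) A Sub.∈? members 𝓕

_⊆ᶠ_ : ∀ {n} → Family n → Family n → Set
𝓖 ⊆ᶠ 𝓕 = ∀ A → A ∈ᶠ 𝓖 → A ∈ᶠ 𝓕

-- φ is a bijection from P onto 𝓖 that preserves the order (and need not reflect it).
record IsCopyMap (P : FinPoset) {n : ℕ} (𝓖 : Family n)
                 (φ : FinPoset.Carrier P → Subset n) : Set where
  open FinPoset P
  field
    injective : Injective _≡_ _≡_ φ
    image     : ∀ A → A ∈ᶠ 𝓖 ⇔ (∃[ x ] φ x ≡ A)
    monotone  : φ Preserves _≤ᴾ_ ⟶ _⊆_

IsCopy : FinPoset → ∀ {n} → Family n → Set
IsCopy P 𝓖 = ∃[ φ ] IsCopyMap P 𝓖 φ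

module _ {A : Set} {m : ℕ} (fin : A ↔ Fin m) where
  open Inverse fin

  allFinite? : {Q : A → Set} → Decidable Q → Dec (∀ x → Q x)
  allFinite? {Q} Q? = map′
    (λ f x → subst Q (strictlyInverseʳ x) (f (to x)))
    (λ f i → f (from i))
    (Fin.all? (λ i → Q? (from i)))

  anyFinite? : {Q : A → Set} → Decidable Q → Dec (∃ Q)
  anyFinite? {Q} Q? = map′
    (λ (i , q) → from i , q)
    (λ (x , q) → to x , subst Q (sym (strictlyInverseʳ x)) q)
    (Fin.any? (λ i → Q? (from i)))

_⊆ᶠ?_ : ∀ {n} (𝓖 𝓕 : Family n) → Dec (𝓖 ⊆ᶠ 𝓕)
𝓖 ⊆ᶠ? 𝓕 = allFinite? (code _) (λ A → (A ∈ᶠ? 𝓖) →-dec (A ∈ᶠ? 𝓕))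

module _ (P : FinPoset) {n : ℕ} (𝓖 : Family n) where
  open FinPoset P

  private
    module F = Inverse finite
    module C = Inverse (code n)

    _≟ˢ_ : DecidableEquality (Subset n)
    _≟ˢ_ = ≡-decᵛ Bool._≟_

  isCopyMap? : Decidable (IsCopyMap P 𝓖)
  isCopyMap? φ = map′
    (λ (i , c , m) → record
      { injective = λ {x} {y} → i x y
      ; image     = λ A → mk⇔ (proj₁ (c A)) (proj₂ (c A))
      ; monotone  = λ {x} {y} → m x y
      })
    (λ copy → let open IsCopyMap copy in
        (λ x y → injective)
      , (λ A → Equivalence.to (image A) , Equivalence.from (image A))
      , (λ x y → monotone))
    (  allFinite? finite (λ x → allFinite? finite λ y →
         (φ x ≟ˢ φ y) →-dec (x ≟ᴾ y))
    ×-dec allFinite? (code n) (λ A →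
         ((A ∈ᶠ? 𝓖) →-dec image? A) ×-dec (image? A →-dec (A ∈ᶠ? 𝓖)))
    ×-dec allFinite? finite (λ x → allFinite? finite λ y →
         (x ≤ᴾ? y) →-dec (φ x Sub.⊆? φ y)))
    where
    image? : ∀ A → Dec (∃[ x ] φ x ≡ A)
    image? A = anyFinite? finite (λ x → φ x ≟ˢ A)

  isCopyMap-resp : ∀ {φ ψ} → φ ≗ ψ → IsCopyMap P 𝓖 φ → IsCopyMap P 𝓖 ψ
  isCopyMap-resp {φ} {ψ} eq copy = record
    { injective = λ {x} {y} e → injective (trans (eq x) (trans e (sym (eq y))))
    ; image     = λ A → mk⇔
        (λ a → let (x , e) = Equivalence.to (image A) a in x , trans (sym (eq x)) e)
        (λ (x , e) → Equivalence.from (image A) (x , trans (eq x) e))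
    ; monotone  = λ {x} {y} x≤y → subst₂ _⊆_ (eq x) (eq y) (monotone x≤y)
    }
    where open IsCopyMap copy

  isCopy? : Dec (IsCopy P 𝓖)
  isCopy? = map′
    (λ (k , copy) → decode k , copy)
    (λ (φ , copy) → encode φ , isCopyMap-resp (λ x → sym (decode-encode φ x)) copy)
    (Fin.any? (λ k → isCopyMap? (decode k)))
    where
    decode : Fin ((2 ^ n) ^ size) → Carrier → Subset n
    decode k x = C.from (finToFun k (F.to x))

    encode : (Carrier → Subset n) → Fin ((2 ^ n) ^ size)
    encode φ = funToFin (λ i → C.to (φ (F.from i)))

    decode-encode : ∀ φ → decode (encode φ) ≗ φ
    decode-encode φ x = trans
      (cong C.from (Fin.finToFun-funToFin (λ i → C.to (φ (F.from i))) (F.to x)))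
      (trans (C.strictlyInverseʳ _) (cong φ (F.strictlyInverseʳ x)))

allSubsets : ∀ m → List (Subset m)
allSubsets zero    = [] ∷ []
allSubsets (suc m) = map (outside ∷_) (allSubsets m) ++ map (inside ∷_) (allSubsets m)

allFamilies : ∀ n → List (Family n)
allFamilies n = map family (allSubsets (2 ^ n))

-- Copies are counted as subfamilies 𝓖, not as maps φ.
c : FinPoset → ∀ {n} → Family n → ℕ
c P {n} 𝓕 = length (filter (λ 𝓖 → (𝓖 ⊆ᶠ? 𝓕) ×-dec isCopy? P 𝓖) (allFamilies n))

Free : FinPoset → ∀ {n} → Family n → Set
Free P 𝓕 = c P 𝓕 ≡ 0

free? : ∀ P {n} → Decidable (Free P {n})
free? P 𝓕 = c P 𝓕 ℕ.≟ 0

-- For nonempty P the empty family is P-free, so the base value 0 never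
-- exceeds the maximum over P-free families.
La : ℕ → FinPoset → FinPoset → ℕ
La n P Q = max 0 (map (c Q) (filter (free? P) (allFamilies n)))

-- 𝓕 is the union of the levels ([n] choose k) for k in ks.
UnionOfFullLevels : ∀ {n} → Family n → Set
UnionOfFullLevels 𝓕 = ∃[ ks ] (∀ A → A ∈ᶠ 𝓕 ⇔ ∣ A ∣ ∈ˡ ks)

infix 4 _=O_

_=O_ : (ℕ → ℕ) → (ℕ → ℕ) → Set
f =O g = ∃[ C ] ∃[ N ] (∀ n → N ≤ n → f n ≤ C * g n)

{-# OPTIONS --safe #-}
-- Order-preserving maps from P to 2^[n] are words of length n over the M up-sets of P, the
-- k-th letter being the set of those x whose image contains k.  Hence every family contains
-- at most M^n copies of P, chain-free or not.  Conversely, restrict to words in which each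
-- |φ(x)| equals ⌊n/M⌋ times the number of up-sets containing x: a pigeonhole argument costs
-- only a polynomial factor.  In K_{r₁,…,r_s} the elements of one level are exchanged by
-- automorphisms, so these sizes depend on the level only, and the copies lie in a union of
-- s full levels.

module Submission where

open import Defs
open import Data.Nat.Base
  using (ℕ; zero; suc; _+_; _*_; _^_; _∸_; _≤_; _<_; z≤n; s≤s; NonZero)
open import Data.Nat.DivMod
  using (_/_; _%_; _mod_; m%n<n; m<n⇒m%n≡m; m%n%n≡m%n; %-distribˡ-+; [m+n]%n≡m%n;
         m/n≤m; m≥n⇒m/n>0; m≡m%n+[m/n]*n)
import Data.Nat.Properties as ℕ
open import Algebra.Properties.CommutativeMonoid.Sum ℕ.+-0-commutativeMonoid
  using (sum; sum-cong-≗; sum-permute; ∑-distrib-+; sum-replicate-zero)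
open import Data.Bool.Base using (Bool; true; false; if_then_else_)
import Data.Bool.Properties as Bool
open import Data.Fin.Base
  using (Fin; zero; suc; toℕ; fromℕ<; inject≤; combine; remQuot; finToFun; funToFin)
import Data.Fin.Base as Fin
open import Data.Fin.Permutation using (permutation)
import Data.Fin.Properties as Fin
open import Data.Fin.Subset using (Subset; _⊆_; ∣_∣; inside; outside)
import Data.Fin.Subset as Sub
import Data.Fin.Subset.Properties as Sub
open import Data.List.Base using (List; []; length; filter; allFin; tabulate; lookup)
open import Data.List.Extrema.Nat using (argmax; f[xs]≤f[argmax]; max≤v⁺)
open import Data.List.Membership.Propositional using () renaming (_∈_ to _∈ˡ_)
open import Data.List.Membership.DecPropositional ℕ._≟_ using (_∈?_)
open import Data.List.Membership.Propositional.Properties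
  using (∈-lookup; ∈-filter⁺; ∈-filter⁻; ∈-allFin; ∈-map⁺; ∈-map⁻; ∈-++⁺ˡ; ∈-++⁺ʳ;
         ∈-tabulate⁺; ∈-tabulate⁻)
open import Data.List.Properties using (filter-none)
open import Data.List.Relation.Unary.All using (All)
import Data.List.Relation.Unary.All as All
import Data.List.Relation.Unary.All.Properties as All
open import Data.List.Relation.Unary.AllPairs using ([]; _∷_)
open import Data.List.Relation.Unary.Any using (here; index)
open import Data.List.Relation.Unary.Any.Properties using (lookup-index)
open import Data.List.Relation.Unary.Unique.Propositional using (Unique)
import Data.List.Relation.Unary.Unique.Propositional.Properties as Unique
open import Data.Nat.Solver using (module +-*-Solver)
open +-*-Solver using (solve; _:*_; _:=_)
open import Data.Product.Base using (Σ-syntax; ∃; ∃-syntax; _×_; _,_; proj₁; proj₂)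
open import Data.Sum.Base using (inj₁; inj₂)
open import Data.Vec.Base as Vec using (Vec; []; _∷_; _++_)
import Data.Vec.Properties as Vec
open import Function.Base using (_∘_; id)
open import Function.Bundles using (_⇔_; Inverse; Equivalence; mk⇔)
open import Function.Definitions using (Injective)
open import Relation.Binary.Definitions using (DecidableEquality)
open import Relation.Binary.Structures using (IsDecPartialOrder)
open import Relation.Binary.PropositionalEquality
  using (_≡_; _≢_; refl; sym; trans; cong; cong₂; subst; subst₂; _≗_; module ≡-Reasoning)
open import Relation.Nullary.Decidable using (Dec; yes; no; does; dec-true; _→-dec_; _×-dec_)
open import Relation.Nullary.Negation using (¬_; contradiction)
open import Relation.Unary using (Decidable)

-- Finite counting

-- Choosing a related element for each `i` gives an injective function. The relational form lets a
-- copy be related to every word that describes it, with the choice of one word left to `total`.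
total-injective⇒≤ : ∀ {m n} (R : Fin m → Fin n → Set) → (∀ i → ∃ (R i)) →
  (∀ {i j y} → R i y → R j y → i ≡ j) → m ≤ n
total-injective⇒≤ R total inj = Fin.injective⇒≤ {f = λ i → proj₁ (total i)} λ {i} {j} eq →
  inj (proj₂ (total i)) (subst (R j) (sym eq) (proj₂ (total j)))

lookup-injective : ∀ {A : Set} {xs : List A} → Unique xs → Injective _≡_ _≡_ (lookup xs)
lookup-injective (_ ∷ _)   {zero}  {zero}  _  = refl
lookup-injective (x≢ ∷ _)  {zero}  {suc j} eq =
  contradiction eq (All.lookup x≢ (∈-lookup j))
lookup-injective (x≢ ∷ _)  {suc i} {zero}  eq =
  contradiction (sym eq) (All.lookup x≢ (∈-lookup i))
lookup-injective (_ ∷ uxs) {suc i} {suc j} eq = cong suc (lookup-injective uxs eq)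

fibre : ∀ {m k} → (Fin m → Fin k) → Fin k → List (Fin m)
fibre f v = filter (λ i → f i Fin.≟ v) (allFin _)

∈-fibre : ∀ {m k} (f : Fin m → Fin k) i → i ∈ˡ fibre f (f i)
∈-fibre f i = ∈-filter⁺ (λ j → f j Fin.≟ f i) (∈-allFin i) refl

-- Each `i` is encoded by its value `f i` together with its position in the fibre over that value.
fibres-bounded⇒≤ : ∀ {m k b} (f : Fin m → Fin k) → (∀ v → length (fibre f v) ≤ b) → m ≤ k * b
fibres-bounded⇒≤ {m} {k} {b} f bound = total-injective⇒≤ (λ i → R i ∘ remQuot {k} b) total inj
  where
  R : Fin m → Fin k × Fin b → Set
  R i (v , j) = Σ[ p ∈ Fin (length (fibre f v)) ] lookup (fibre f v) p ≡ i × toℕ p ≡ toℕ j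

  total : ∀ i → ∃ (R i ∘ remQuot {k} b)
  total i = combine (f i) j , subst (R i) (sym (Fin.remQuot-combine (f i) j))
    (p , sym (lookup-index (∈-fibre f i)) , sym (Fin.toℕ-inject≤ p (bound (f i))))
    where
    p = index (∈-fibre f i)
    j = inject≤ p (bound (f i))

  inj : ∀ {i j y} → R i (remQuot {k} b y) → R j (remQuot {k} b y) → i ≡ j
  inj {y = y} (p , p↦i , p≡) (p′ , p′↦j , p′≡) = trans (sym p↦i) (trans
    (cong (lookup (fibre f (proj₁ (remQuot {k} b y)))) (Fin.toℕ-injective (trans p≡ (sym p′≡))))
    p′↦j)

largest-fibre : ∀ {m k} → Fin k → (f : Fin m → Fin k) → ∃[ v ] m ≤ k * length (fibre f v)
largest-fibre {k = k} v₀ f = argmax (length ∘ fibre f) v₀ (allFin k) , fibres-bounded⇒≤ f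
  (λ v → All.lookup (f[xs]≤f[argmax] {f = length ∘ fibre f} v₀ (allFin k)) (∈-allFin v))

funToFin-cong : ∀ {m k} {f g : Fin m → Fin k} → f ≗ g → funToFin f ≡ funToFin g
funToFin-cong {zero}  _  = refl
funToFin-cong {suc m} eq = cong₂ combine (eq zero) (funToFin-cong (eq ∘ suc))

finToFun-injective : ∀ m k {x y : Fin (k ^ m)} → finToFun {k} {m} x ≗ finToFun y → x ≡ y
finToFun-injective m k {x} {y} eq = trans (sym (Fin.funToFin-finToFin {m} {k} x))
  (trans (funToFin-cong eq) (Fin.funToFin-finToFin {m} {k} y))

tabulate-injective : ∀ {A : Set} {n} {f g : Fin n → A} → Vec.tabulate f ≡ Vec.tabulate g → f ≗ g
tabulate-injective {f = f} {g} eq i = trans (sym (Vec.lookup∘tabulate f i))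
  (trans (cong (λ v → Vec.lookup v i) eq) (Vec.lookup∘tabulate g i))

word : ∀ {M} n → Fin (M ^ n) → Vec (Fin M) n
word n u = Vec.tabulate (finToFun u)

word-injective : ∀ {M} n {u v : Fin (M ^ n)} → word n u ≡ word n v → u ≡ v
word-injective {M} n eq = finToFun-injective n M (tabulate-injective eq)

word-surjective : ∀ {M n} (w : Vec (Fin M) n) → ∃[ u ] word n u ≡ w
word-surjective w = funToFin (Vec.lookup w) ,
  trans (Vec.tabulate-cong (Fin.finToFun-funToFin (Vec.lookup w))) (Vec.tabulate∘lookup w)

allSubsets-complete : ∀ {m} (A : Subset m) → A ∈ˡ allSubsets m
allSubsets-complete []            = here refl
allSubsets-complete (outside ∷ A) = ∈-++⁺ˡ (∈-map⁺ _ (allSubsets-complete A))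
allSubsets-complete (inside ∷ A)  = ∈-++⁺ʳ _ (∈-map⁺ _ (allSubsets-complete A))

allSubsets-unique : ∀ m → Unique (allSubsets m)
allSubsets-unique zero    = All.[] ∷ []
allSubsets-unique (suc m) = Unique.++⁺
  (Unique.map⁺ Vec.∷-injectiveʳ (allSubsets-unique m))
  (Unique.map⁺ Vec.∷-injectiveʳ (allSubsets-unique m))
  λ (A∈ , A∈′) → disjoint (∈-map⁻ _ A∈) (∈-map⁻ _ A∈′)
  where
  disjoint : ∀ {A} → ∃[ B ] (B ∈ˡ allSubsets m × A ≡ outside ∷ B) →
    ¬ (∃[ B ] (B ∈ˡ allSubsets m × A ≡ inside ∷ B))
  disjoint (_ , _ , refl) (_ , _ , ())

does⇒ : ∀ {A : Set} (A? : Dec A) → does A? ≡ true → A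
does⇒ (yes a) _ = a

-- Families

_≟ˢ_ : ∀ {n} → DecidableEquality (Subset n)
_≟ˢ_ = Vec.≡-dec Bool._≟_

module _ {n : ℕ} where
  private module C = Inverse (code n)

  comprehension : {Q : Subset n → Set} → Decidable Q → Family n
  comprehension Q? = family (Vec.tabulate (λ k → does (Q? (C.from k))))

  ∈-comprehension : {Q : Subset n → Set} (Q? : Decidable Q) →
    ∀ A → A ∈ᶠ comprehension Q? ⇔ Q A
  ∈-comprehension {Q} Q? A = mk⇔
    (λ A∈ → subst Q (C.strictlyInverseʳ A) (does⇒ (Q? (C.from (C.to A)))
      (trans (sym (Vec.lookup∘tabulate _ (C.to A))) (Vec.[]=⇒lookup A∈))))
    (λ q → Vec.lookup⇒[]= _ _ (trans (Vec.lookup∘tabulate _ (C.to A))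
      (dec-true (Q? _) (subst Q (sym (C.strictlyInverseʳ A)) q))))

  ⊆ᶠ⇒⊆ : {𝓕 𝓖 : Family n} → 𝓕 ⊆ᶠ 𝓖 → members 𝓕 ⊆ members 𝓖
  ⊆ᶠ⇒⊆ {𝓕} {𝓖} sub {k} k∈ = subst (Sub._∈ members 𝓖) (C.strictlyInverseˡ k)
    (sub (C.from k) (subst (Sub._∈ members 𝓕) (sym (C.strictlyInverseˡ k)) k∈))

  ⊆ᶠ-antisym : {𝓕 𝓖 : Family n} → 𝓕 ⊆ᶠ 𝓖 → 𝓖 ⊆ᶠ 𝓕 → 𝓕 ≡ 𝓖
  ⊆ᶠ-antisym sub sup = cong family (Sub.⊆-antisym (⊆ᶠ⇒⊆ sub) (⊆ᶠ⇒⊆ sup))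

allFamilies-complete : ∀ {n} (𝓕 : Family n) → 𝓕 ∈ˡ allFamilies n
allFamilies-complete (family A) = ∈-map⁺ family (allSubsets-complete A)

allFamilies-unique : ∀ n → Unique (allFamilies n)
allFamilies-unique n = Unique.map⁺ (cong members) (allSubsets-unique (2 ^ n))

module _ (P : FinPoset) {n : ℕ} where
  open FinPoset P

  copies : Family n → List (Family n)
  copies 𝓕 = filter (λ 𝓖 → (𝓖 ⊆ᶠ? 𝓕) ×-dec isCopy? P 𝓖) (allFamilies n)

  copies⁻ : ∀ {𝓕 𝓖} → 𝓖 ∈ˡ copies 𝓕 → 𝓖 ⊆ᶠ 𝓕 × IsCopy P 𝓖
  copies⁻ {𝓕} 𝓖∈ = proj₂ (∈-filter⁻ (λ 𝓖 → (𝓖 ⊆ᶠ? 𝓕) ×-dec isCopy? P 𝓖) {xs = allFamilies n} 𝓖∈)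

  copies⁺ : ∀ {𝓕 𝓖} → 𝓖 ⊆ᶠ 𝓕 → IsCopy P 𝓖 → 𝓖 ∈ˡ copies 𝓕
  copies⁺ {𝓕} {𝓖} sub copy =
    ∈-filter⁺ (λ 𝓖 → (𝓖 ⊆ᶠ? 𝓕) ×-dec isCopy? P 𝓖) (allFamilies-complete 𝓖) (sub , copy)

  copies-unique : ∀ 𝓕 → Unique (copies 𝓕)
  copies-unique 𝓕 = Unique.filter⁺ (λ 𝓖 → (𝓖 ⊆ᶠ? 𝓕) ×-dec isCopy? P 𝓖) (allFamilies-unique n)

  copy-image-⊆ : ∀ {𝓖 𝓗 : Family n} {φ} → IsCopyMap P 𝓖 φ → IsCopyMap P 𝓗 φ → 𝓖 ⊆ᶠ 𝓗
  copy-image-⊆ copy copy′ A A∈ = Equivalence.from (IsCopyMap.image copy′ A)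
    (Equivalence.to (IsCopyMap.image copy A) A∈)

  imageFamily : (Carrier → Subset n) → Family n
  imageFamily φ = comprehension (λ A → anyFinite? finite (λ x → φ x ≟ˢ A))

  imageFamily-copy : ∀ {φ} → Injective _≡_ _≡_ φ → (∀ {x y} → x ≤ᴾ y → φ x ⊆ φ y) →
    IsCopyMap P (imageFamily φ) φ
  imageFamily-copy {φ} inj mono = record
    { injective = inj
    ; image     = ∈-comprehension (λ A → anyFinite? finite (λ x → φ x ≟ˢ A))
    ; monotone  = mono
    }

-- Words over the alphabet of up-sets

column : ∀ {M m n} → (Fin M → Fin m → Bool) → Vec (Fin M) n → Fin m → Subset n
column χ w e = Vec.map (λ t → χ t e) w

module UpSets (P : FinPoset) where
  open FinPoset P
  private
    module F = Inverse finite
    module P = IsDecPartialOrder isDecPartialOrder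

  Monotone : (Carrier → Bool) → Set
  Monotone b = ∀ x y → x ≤ᴾ y → b x ≡ true → b y ≡ true

  IsUpSet : Subset size → Set
  IsUpSet A = Monotone (λ x → Vec.lookup A (F.to x))

  isUpSet? : Decidable IsUpSet
  isUpSet? A = allFinite? finite λ x → allFinite? finite λ y →
    (x ≤ᴾ? y) →-dec ((_ Bool.≟ true) →-dec (_ Bool.≟ true))

  upSets : List (Subset size)
  upSets = filter isUpSet? (allSubsets size)

  M : ℕ
  M = length upSets

  -- Elements are numbered here, so that the counting of column sizes can treat `χ` as a plain
  -- Boolean matrix; `_∋_` is the same matrix read on `Carrier`.
  χ : Fin M → Fin size → Bool
  χ t e = Vec.lookup (lookup upSets t) e

  _∋_ : Fin M → Carrier → Bool
  t ∋ x = χ t (F.to x)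

  ∋-monotone : ∀ t → Monotone (t ∋_)
  ∋-monotone t = proj₂ (∈-filter⁻ isUpSet? {xs = allSubsets size} (∈-lookup t))

  ∋-complete : ∀ b → Monotone b → ∃[ t ] (t ∋_) ≗ b
  ∋-complete b mono = index A∈ , λ x → trans
    (cong (λ B → Vec.lookup B (F.to x)) (sym (lookup-index A∈))) (lookup-A x)
    where
    A = Vec.tabulate (b ∘ F.from)
    lookup-A : ∀ x → Vec.lookup A (F.to x) ≡ b x
    lookup-A x = trans (Vec.lookup∘tabulate _ (F.to x)) (cong b (F.strictlyInverseʳ x))
    A∈ : A ∈ˡ upSets
    A∈ = ∈-filter⁺ isUpSet? (allSubsets-complete A) λ x y x≤y bx →
      trans (lookup-A y) (mono x y x≤y (trans (sym (lookup-A x)) bx))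

  ∋-injective : ∀ {t u} → (t ∋_) ≗ (u ∋_) → t ≡ u
  ∋-injective {t} {u} eq = lookup-injective (Unique.filter⁺ isUpSet? (allSubsets-unique size))
    (trans (sym (Vec.tabulate∘lookup _))
    (trans (Vec.tabulate-cong λ e → subst (λ e → χ t e ≡ χ u e) (F.strictlyInverseˡ e) (eq (F.from e)))
           (Vec.tabulate∘lookup _)))

  ∅ : Fin M
  ∅ = proj₁ (∋-complete (λ _ → false) (λ _ _ _ ()))

  ∅-empty : ∀ x → ∅ ∋ x ≡ false
  ∅-empty = proj₂ (∋-complete (λ _ → false) (λ _ _ _ ()))

  principal : ∀ x → ∃[ t ] (t ∋_) ≗ (λ z → does (x ≤ᴾ? z))
  principal x = ∋-complete _ λ y z y≤z x≤y →
    dec-true (x ≤ᴾ? z) (P.trans (does⇒ (x ≤ᴾ? y) x≤y) y≤z)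

  -- The principal up-set of `x` contains `x`, hence also `y`, so `x` lies below `y`. Exchanging the
  -- roles and antisymmetry finish the argument.
  ∋-separates : ∀ {x y} → (∀ t → t ∋ x ≡ t ∋ y) → x ≡ y
  ∋-separates {x} {y} eq = P.antisym (below x y eq) (below y x (sym ∘ eq))
    where
    below : ∀ x y → (∀ t → t ∋ x ≡ t ∋ y) → x ≤ᴾ y
    below x y eq with t , t≗ ← principal x = does⇒ (x ≤ᴾ? y)
      (trans (sym (t≗ y)) (trans (sym (eq t)) (trans (t≗ x) (dec-true (x ≤ᴾ? x) P.refl))))

  wordMap : ∀ {n} → Vec (Fin M) n → Carrier → Subset n
  wordMap w x = column χ w (F.to x)

  wordMap-monotone : ∀ {n} (w : Vec (Fin M) n) {x y} → x ≤ᴾ y → wordMap w x ⊆ wordMap w y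
  wordMap-monotone w {x} {y} x≤y {k} k∈ = Vec.lookup⇒[]= _ _
    (trans (Vec.lookup-map k (_∋ y) w)
      (∋-monotone (Vec.lookup w k) x y x≤y
        (trans (sym (Vec.lookup-map k (_∋ x) w)) (Vec.[]=⇒lookup k∈))))

  wordMap-injective : ∀ {n} (w v : Vec (Fin M) n) → wordMap w ≗ wordMap v → w ≡ v
  wordMap-injective []      []      _  = refl
  wordMap-injective (t ∷ w) (u ∷ v) eq = cong₂ _∷_
    (∋-injective (Vec.∷-injectiveˡ ∘ eq)) (wordMap-injective w v (Vec.∷-injectiveʳ ∘ eq))

  wordMap-complete : ∀ {n} (φ : Carrier → Subset n) → (∀ {x y} → x ≤ᴾ y → φ x ⊆ φ y) →
    ∃[ w ] wordMap w ≗ φ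
  wordMap-complete φ mono = Vec.tabulate (proj₁ ∘ letter) , λ x → trans
    (sym (Vec.tabulate-∘ (_∋ x) (proj₁ ∘ letter)))
    (trans (Vec.tabulate-cong (λ k → proj₂ (letter k) x)) (Vec.tabulate∘lookup (φ x)))
    where
    letter : ∀ k → ∃[ t ] (t ∋_) ≗ (λ x → Vec.lookup (φ x) k)
    letter k = ∋-complete _ λ x y x≤y k∈ →
      Vec.[]=⇒lookup (mono x≤y (Vec.lookup⇒[]= k (φ x) k∈))

  -- A copy is related to the words of its copy maps. A word determines its map, and the map
  -- determines its image, so no word serves two copies.
  c≤M^n : ∀ {n} (𝓕 : Family n) → c P 𝓕 ≤ M ^ n
  c≤M^n {n} 𝓕 = total-injective⇒≤ R total
    (λ r r′ → lookup-injective (copies-unique P 𝓕)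
      (⊆ᶠ-antisym (copy-image-⊆ P {n} r r′) (copy-image-⊆ P r′ r)))
    where
    R : Fin (c P 𝓕) → Fin (M ^ n) → Set
    R i u = IsCopyMap P (lookup (copies P 𝓕) i) (wordMap (word n u))

    total : ∀ i → ∃ (R i)
    total i with (_ , φ , copy) ← copies⁻ P {𝓕 = 𝓕} (∈-lookup i)
            with w , w≗ ← wordMap-complete φ (IsCopyMap.monotone copy)
            with u , refl ← word-surjective w
            = u , isCopyMap-resp P _ (sym ∘ w≗) copy

  La≤M^n : ∀ n Q → La n Q P ≤ M ^ n
  La≤M^n n Q = max≤v⁺ z≤n (All.map⁺ (All.universal (c≤M^n {n}) (filter (free? Q) (allFamilies n))))

  -- All maps onto a given copy arise from any one of them by composing with a self-map
  -- of P, so there are at most |P|^|P| of them.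
  words≤copies : ∀ {N n} (𝓕 : Family n) (w : Fin N → Vec (Fin M) n) → Injective _≡_ _≡_ w →
    (∀ i → Injective _≡_ _≡_ (wordMap (w i))) → (∀ i x → wordMap (w i) x ∈ᶠ 𝓕) →
    N ≤ c P 𝓕 * size ^ size
  words≤copies {N} {n} 𝓕 w w-inj φ-inj φ∈ = total-injective⇒≤ R total λ {i} {j} r r′ →
    w-inj (wordMap-injective (w i) (w j) λ x → trans (r x) (sym (r′ x)))
    where
    copy : ∀ j → IsCopy P (lookup (copies P 𝓕) j)
    copy j = proj₂ (copies⁻ P {𝓕 = 𝓕} (∈-lookup j))

    ψ : Fin (c P 𝓕) → Fin (size ^ size) → Carrier → Subset n
    ψ j σ x = proj₁ (copy j) (F.from (finToFun σ (F.to x)))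

    R : Fin N → Fin (c P 𝓕 * size ^ size) → Set
    R i y = wordMap (w i) ≗ ψ (proj₁ (remQuot _ y)) (proj₂ (remQuot {c P 𝓕} _ y))

    total : ∀ i → ∃ (R i)
    total i = combine j σ , λ x → trans (eq x)
      (cong (λ (j , σ) → ψ j σ x) (sym (Fin.remQuot-combine j σ)))
      where
      φ = wordMap (w i)
      φ-copy = imageFamily-copy P (φ-inj i) (wordMap-monotone (w i))

      𝓖∈ : imageFamily P φ ∈ˡ copies P 𝓕
      𝓖∈ = copies⁺ P (λ A A∈ → let x , φx≡A = Equivalence.to (IsCopyMap.image φ-copy A) A∈ in
        subst (_∈ᶠ 𝓕) φx≡A (φ∈ i x)) (φ , φ-copy)

      j = index 𝓖∈

      -- `φ` and the map chosen for the `j`-th copy have the same image, so every `φ x` has a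
      -- preimage under the chosen map. These preimages form the self-map `σ′`.
      hit : ∀ x → ∃[ y ] proj₁ (copy j) y ≡ φ x
      hit x = Equivalence.to (IsCopyMap.image (proj₂ (copy j)) (φ x))
        (subst (φ x ∈ᶠ_) (lookup-index 𝓖∈) (Equivalence.from (IsCopyMap.image φ-copy (φ x)) (x , refl)))

      σ′ : Fin size → Fin size
      σ′ e = F.to (proj₁ (hit (F.from e)))

      σ : Fin (size ^ size)
      σ = funToFin σ′

      eq : φ ≗ ψ j σ
      eq x = sym (trans (cong (proj₁ (copy j)) (trans
          (cong F.from (trans (Fin.finToFun-funToFin σ′ (F.to x))
            (cong (F.to ∘ proj₁ ∘ hit) (F.strictlyInverseʳ x))))
          (F.strictlyInverseʳ _)))
        (proj₂ (hit x)))

-- Words with prescribed column sizes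

indicator : Bool → ℕ
indicator b = if b then 1 else 0

∣∷∣ : ∀ {n} b (A : Subset n) → ∣ b ∷ A ∣ ≡ indicator b + ∣ A ∣
∣∷∣ true  _ = refl
∣∷∣ false _ = refl

∣++∣ : ∀ {m n} (A : Subset m) (B : Subset n) → ∣ A ++ B ∣ ≡ ∣ A ∣ + ∣ B ∣
∣++∣ []      B = refl
∣++∣ (b ∷ A) B = begin
  ∣ b ∷ A ++ B ∣                ≡⟨ ∣∷∣ b (A ++ B) ⟩
  indicator b + ∣ A ++ B ∣      ≡⟨ cong (indicator b +_) (∣++∣ A B) ⟩
  indicator b + (∣ A ∣ + ∣ B ∣) ≡⟨ ℕ.+-assoc (indicator b) ∣ A ∣ ∣ B ∣ ⟨
  indicator b + ∣ A ∣ + ∣ B ∣   ≡⟨ cong (_+ ∣ B ∣) (∣∷∣ b A) ⟨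
  ∣ b ∷ A ∣ + ∣ B ∣             ∎
  where open ≡-Reasoning

∣tabulate∣ : ∀ {n} (f : Fin n → Bool) → ∣ Vec.tabulate f ∣ ≡ sum (indicator ∘ f)
∣tabulate∣ {zero}  f = refl
∣tabulate∣ {suc n} f =
  trans (∣∷∣ (f zero) (Vec.tabulate (f ∘ suc))) (cong (indicator (f zero) +_) (∣tabulate∣ (f ∘ suc)))

blocks : ∀ {A : Set} {q} m → (Fin m → Vec A q) → Vec A (m * q)
blocks zero    _ = []
blocks (suc m) g = g zero ++ blocks m (g ∘ suc)

blocks-injective : ∀ {A : Set} {q} m {f g : Fin m → Vec A q} →
  blocks m f ≡ blocks m g → f ≗ g
blocks-injective (suc m) {f} {g} eq zero    = Vec.++-injectiveˡ (f zero) (g zero) eq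
blocks-injective (suc m) {f} {g} eq (suc j) =
  blocks-injective m (Vec.++-injectiveʳ (f zero) (g zero) eq) j

map-injective : ∀ {A B : Set} {f : A → B} → Injective _≡_ _≡_ f →
  ∀ {n} → Injective _≡_ _≡_ (Vec.map {n = n} f)
map-injective inj {x = []}    {[]}    _  = refl
map-injective inj {x = _ ∷ _} {_ ∷ _} eq =
  cong₂ _∷_ (inj (Vec.∷-injectiveˡ eq)) (map-injective inj (Vec.∷-injectiveʳ eq))

-- Cyclic rotations of the alphabet

module Rotation (M : ℕ) .{{_ : NonZero M}} where

  rot : ℕ → Fin M → Fin M
  rot j t = (toℕ t + j) mod M

  toℕ-rot : ∀ j t → toℕ (rot j t) ≡ (toℕ t + j) % M
  toℕ-rot j t = Fin.toℕ-fromℕ< (m%n<n (toℕ t + j) M)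

  rot-cancel : ∀ {a b} → a + b ≡ M → ∀ t → rot b (rot a t) ≡ t
  rot-cancel {a} {b} a+b≡M t = Fin.toℕ-injective (begin
    toℕ (rot b (rot a t))                   ≡⟨ toℕ-rot b (rot a t) ⟩
    (toℕ (rot a t) + b) % M                 ≡⟨ cong (λ x → (x + b) % M) (toℕ-rot a t) ⟩
    ((toℕ t + a) % M + b) % M               ≡⟨ %-distribˡ-+ ((toℕ t + a) % M) b M ⟩
    ((toℕ t + a) % M % M + b % M) % M       ≡⟨ cong (λ x → (x + b % M) % M) (m%n%n≡m%n (toℕ t + a) M) ⟩
    ((toℕ t + a) % M + b % M) % M           ≡⟨ %-distribˡ-+ (toℕ t + a) b M ⟨
    (toℕ t + a + b) % M                     ≡⟨ cong (_% M) (trans (ℕ.+-assoc (toℕ t) a b) (cong (toℕ t +_) a+b≡M)) ⟩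
    (toℕ t + M) % M                         ≡⟨ [m+n]%n≡m%n (toℕ t) M ⟩
    toℕ t % M                               ≡⟨ m<n⇒m%n≡m (Fin.toℕ<n t) ⟩
    toℕ t                                   ∎)
    where open ≡-Reasoning

  rot-cancelˡ : ∀ (j : Fin M) t → rot (M ∸ toℕ j) (rot (toℕ j) t) ≡ t
  rot-cancelˡ j = rot-cancel (ℕ.m+[n∸m]≡n (ℕ.<⇒≤ (Fin.toℕ<n j)))

  rot-injective : ∀ (j : Fin M) → Injective _≡_ _≡_ (rot (toℕ j))
  rot-injective j {t} {u} eq =
    trans (sym (rot-cancelˡ j t)) (trans (cong (rot (M ∸ toℕ j)) eq) (rot-cancelˡ j u))

  -- Adding `j` to `t` is adding `t` to `j`: as `j` varies, the argument of `f` is `j` rotated by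
  -- the fixed amount `t`, so the sum is only permuted.
  sum-rot : ∀ (f : Fin M → ℕ) t → sum {M} (λ j → f (rot (toℕ j) t)) ≡ sum f
  sum-rot f t = trans
    (sum-cong-≗ {M} (λ j → cong (λ x → f (x mod M)) (ℕ.+-comm (toℕ t) (toℕ j))))
    (sym (sum-permute f (permutation (rot (toℕ t)) (rot (M ∸ toℕ t))
      (rot-cancel (ℕ.m∸n+n≡m (ℕ.<⇒≤ (Fin.toℕ<n t)))) (rot-cancelˡ t))))

-- Popular profiles and balanced words

^-distribʳ-* : ∀ k m n → (m * n) ^ k ≡ m ^ k * n ^ k
^-distribʳ-* zero    m n = refl
^-distribʳ-* (suc k) m n = trans (cong (m * n *_) (^-distribʳ-* k m n))
  (ℕ.[m*n]*[o*p]≡[m*o]*[n*p] m n (m ^ k) (n ^ k))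

module Balanced {M m : ℕ} .{{_ : NonZero M}} (χ : Fin M → Fin m → Bool) where
  open Rotation M

  -- For the matrix `χ` of up-sets this is the number of up-sets that contain the element `e`.
  degree : Fin m → ℕ
  degree e = sum (λ t → indicator (χ t e))

  -- Over the `M` rotations each position of `w` takes every letter exactly once and so contributes
  -- `degree e`, whatever letter `w` has there.
  sum-rotations : ∀ {n} (w : Vec (Fin M) n) e →
    sum {M} (λ j → ∣ column χ (Vec.map (rot (toℕ j)) w) e ∣) ≡ n * degree e
  sum-rotations []      e = sum-replicate-zero M
  sum-rotations {suc n} (t ∷ w) e = begin
    sum {M} (λ j → ∣ column χ (Vec.map (rot (toℕ j)) (t ∷ w)) e ∣)
      ≡⟨ sum-cong-≗ {M} (λ j → ∣∷∣ (χ (rot (toℕ j) t) e) (column χ (Vec.map (rot (toℕ j)) w) e)) ⟩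
    sum {M} (λ j → indicator (χ (rot (toℕ j) t) e) + ∣ column χ (Vec.map (rot (toℕ j)) w) e ∣)
      ≡⟨ ∑-distrib-+ {M} (λ j → indicator (χ (rot (toℕ j) t) e)) _ ⟩
    sum {M} (λ j → indicator (χ (rot (toℕ j) t) e)) +
      sum {M} (λ j → ∣ column χ (Vec.map (rot (toℕ j)) w) e ∣)
      ≡⟨ cong₂ _+_ (sum-rot (λ t → indicator (χ t e)) t) (sum-rotations w e) ⟩
    degree e + n * degree e ∎
    where open ≡-Reasoning

  ∣column-++∣ : ∀ {k n} (v : Vec (Fin M) k) (w : Vec (Fin M) n) e →
    ∣ column χ (v ++ w) e ∣ ≡ ∣ column χ v e ∣ + ∣ column χ w e ∣
  ∣column-++∣ v w e = trans (cong ∣_∣ (Vec.map-++ (λ t → χ t e) v w)) (∣++∣ (column χ v e) _)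

  ∣column-blocks∣ : ∀ {q} k (g : Fin k → Vec (Fin M) q) e →
    ∣ column χ (blocks k g) e ∣ ≡ sum (λ j → ∣ column χ (g j) e ∣)
  ∣column-blocks∣ zero    g e = refl
  ∣column-blocks∣ (suc k) g e = trans (∣column-++∣ (g zero) (blocks k (g ∘ suc)) e)
    (cong (∣ column χ (g zero) e ∣ +_) (∣column-blocks∣ k (g ∘ suc) e))

  module _ (q : ℕ) where

    blockSize : Fin M → Fin m → Vec (Fin M) q → ℕ
    blockSize j e w = ∣ column χ (Vec.map (rot (toℕ j)) w) e ∣

    blockSize<1+q : ∀ j e w → blockSize j e w < suc q
    blockSize<1+q j e w = s≤s (Sub.∣p∣≤n (column χ (Vec.map (rot (toℕ j)) w) e))

    profileAt : Vec (Fin M) q → Fin M × Fin m → Fin (suc q)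
    profileAt w (j , e) = fromℕ< (blockSize<1+q j e w)

    -- The sizes are recorded under all `M` rotations, since a word may be placed in any block. For
    -- fixed `M` and `m` the number of profiles is polynomial in `q`.
    profile : Fin (M ^ q) → Fin (suc q ^ (M * m))
    profile u = funToFin (profileAt (word q u) ∘ remQuot m)

    profile⇒blockSize : ∀ {u v} → profile u ≡ profile v →
      ∀ j e → blockSize j e (word q u) ≡ blockSize j e (word q v)
    profile⇒blockSize {u} {v} eq j e = begin
      blockSize j e (word q u)
        ≡⟨ Fin.toℕ-fromℕ< (blockSize<1+q j e (word q u)) ⟨
      toℕ (profileAt (word q u) (j , e))
        ≡⟨ cong toℕ (trans (sym (at u)) (trans (cong (λ p → finToFun p (combine j e)) eq) (at v))) ⟩
      toℕ (profileAt (word q v) (j , e))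
        ≡⟨ Fin.toℕ-fromℕ< (blockSize<1+q j e (word q v)) ⟩
      blockSize j e (word q v) ∎
      where
      open ≡-Reasoning
      at : ∀ u → finToFun (profile u) (combine j e) ≡ profileAt (word q u) (j , e)
      at u = trans (Fin.finToFun-funToFin (profileAt (word q u) ∘ remQuot m) (combine j e))
        (cong (profileAt (word q u)) (Fin.remQuot-combine j e))

    -- By pigeonhole many words of length q share the column sizes of all their rotations;
    -- with the j-th of M such words rotated by j, the column sizes of the concatenation
    -- are those of the M rotations of a single word.
    balanced : ∃[ N ] M ^ (M * q) ≤ (suc q ^ (M * m)) ^ M * N ×
      Σ[ w ∈ (Fin N → Vec (Fin M) (M * q)) ] Injective _≡_ _≡_ w ×
      (∀ i e → ∣ column χ (w i) e ∣ ≡ q * degree e)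
    balanced = N , bound , w , w-injective , w-size
      where
      -- The constant zero profile is only a starting value for the search for the largest fibre.
      popular : ∃[ v ] M ^ q ≤ suc q ^ (M * m) * length (fibre profile v)
      popular = largest-fibre (funToFin {M * m} (λ _ → zero)) profile

      G : List (Fin (M ^ q))
      G = fibre profile (proj₁ popular)

      profile-G : ∀ p → profile (lookup G p) ≡ proj₁ popular
      profile-G p = proj₂ (∈-filter⁻ (λ i → profile i Fin.≟ proj₁ popular)
        {xs = allFin (M ^ q)} (∈-lookup p))

      G-unique : Unique G
      G-unique = Unique.filter⁺ (λ i → profile i Fin.≟ proj₁ popular) (Unique.allFin⁺ (M ^ q))

      -- Each of the `M` blocks receives a word of `G` independently of the others. The pigeonhole
      -- loss is thereby raised to the power `M` and stays polynomial in `q`.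
      N = length G ^ M

      bound : M ^ (M * q) ≤ (suc q ^ (M * m)) ^ M * N
      bound = begin
        M ^ (M * q)                            ≡⟨ cong (M ^_) (ℕ.*-comm M q) ⟩
        M ^ (q * M)                            ≡⟨ ℕ.^-*-assoc M q M ⟨
        (M ^ q) ^ M                            ≤⟨ ℕ.^-monoˡ-≤ M (proj₂ popular) ⟩
        (suc q ^ (M * m) * length G) ^ M       ≡⟨ ^-distribʳ-* M (suc q ^ (M * m)) (length G) ⟩
        (suc q ^ (M * m)) ^ M * length G ^ M   ∎
        where open ℕ.≤-Reasoning

      letterBlock : Fin N → Fin M → Vec (Fin M) q
      letterBlock i j = word q (lookup G (finToFun i j))

      w : Fin N → Vec (Fin M) (M * q)
      w i = blocks M (λ j → Vec.map (rot (toℕ j)) (letterBlock i j))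

      w-injective : Injective _≡_ _≡_ w
      w-injective eq = finToFun-injective M (length G) λ j →
        lookup-injective G-unique (word-injective q
          (map-injective (rot-injective j) (blocks-injective M eq j)))

      w-size : ∀ i e → ∣ column χ (w i) e ∣ ≡ q * degree e
      w-size i e = begin
        ∣ column χ (w i) e ∣
          ≡⟨ ∣column-blocks∣ M (λ j → Vec.map (rot (toℕ j)) (letterBlock i j)) e ⟩
        sum (λ j → blockSize j e (letterBlock i j))
          -- The words of block `j` and block `j₀` have the same profile and are compared under the
          -- same rotation, by `j`.
          ≡⟨ sum-cong-≗ (λ j → profile⇒blockSize
               (trans (profile-G (finToFun i j)) (sym (profile-G (finToFun i j₀)))) j e) ⟩
        sum (λ j → blockSize j e (letterBlock i j₀))
          ≡⟨ sum-rotations (letterBlock i j₀) e ⟩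
        q * degree e ∎
        where
        open ≡-Reasoning
        j₀ = 0 mod M

-- In the application `a` is the number of copies and `b` bounds the number of maps onto one copy.
-- The length splits into a prefix of `M` letters, `M` blocks of length `q` and a padding of `ρ`
-- letters; prefix and padding cost a factor of at most `M ^ M` each.
power-bound : ∀ M .{{_ : NonZero M}} q ρ e a b {n} → ρ ≤ M → suc q ≤ n →
  M ^ (M * q) ≤ (suc q ^ e) ^ M * (a * b) →
  M ^ (M + (M * q + ρ)) ≤ M ^ M * M ^ M * b * (n ^ (e * M) * a)
power-bound M q ρ e a b {n} ρ≤M 1+q≤n words = begin
  M ^ (M + (M * q + ρ))
    ≡⟨ ℕ.^-distribˡ-+-* M M (M * q + ρ) ⟩
  M ^ M * M ^ (M * q + ρ)
    ≡⟨ cong (M ^ M *_) (ℕ.^-distribˡ-+-* M (M * q) ρ) ⟩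
  M ^ M * (M ^ (M * q) * M ^ ρ)
    ≤⟨ ℕ.*-monoʳ-≤ (M ^ M) (ℕ.*-mono-≤ words (ℕ.^-monoʳ-≤ M ρ≤M)) ⟩
  M ^ M * ((suc q ^ e) ^ M * (a * b) * M ^ M)
    ≡⟨ cong (λ k → M ^ M * (k * (a * b) * M ^ M)) (ℕ.^-*-assoc (suc q) e M) ⟩
  M ^ M * (suc q ^ (e * M) * (a * b) * M ^ M)
    ≤⟨ ℕ.*-monoʳ-≤ (M ^ M) (ℕ.*-monoˡ-≤ (M ^ M)
         (ℕ.*-monoˡ-≤ (a * b) (ℕ.^-monoˡ-≤ (e * M) 1+q≤n))) ⟩
  M ^ M * (n ^ (e * M) * (a * b) * M ^ M)
    ≡⟨ rearrange (M ^ M) (n ^ (e * M)) a b ⟩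
  M ^ M * M ^ M * b * (n ^ (e * M) * a) ∎
  where
  open ℕ.≤-Reasoning
  rearrange : ∀ x y z t → x * (y * (z * t) * x) ≡ x * x * t * (y * z)
  rearrange = solve 4 (λ x y z t → x :* (y :* (z :* t) :* x) := x :* x :* t :* (y :* z)) refl

-- Lower bound on the number of copies

module LowerBound (P : FinPoset) where
  open FinPoset P
  open UpSets P
  private module F = Inverse finite

  instance
    M-nonZero : NonZero M
    M-nonZero = Fin.nonZeroIndex ∅

  open Balanced χ using (degree; balanced; ∣column-++∣)

  -- The preimage of an up-set under the monotone map `α` is an up-set, and taking preimages is an
  -- involution `π` of the alphabet. It matches the up-sets containing `α x` with those containing
  -- `x`.
  degree-involution : (α : Carrier → Carrier) → (∀ x y → x ≤ᴾ y → α x ≤ᴾ α y) →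
    (∀ x → α (α x) ≡ x) → ∀ x → degree (F.to x) ≡ degree (F.to (α x))
  degree-involution α mono invol x = trans
    (sum-permute (λ t → indicator (t ∋ x)) (permutation π π π-invol π-invol))
    (sum-cong-≗ (λ t → cong indicator (π∋ t x)))
    where
    preimage : ∀ t → ∃[ u ] (u ∋_) ≗ ((t ∋_) ∘ α)
    preimage t = ∋-complete _ λ x y x≤y → ∋-monotone t (α x) (α y) (mono x y x≤y)

    π : Fin M → Fin M
    π = proj₁ ∘ preimage

    π∋ : ∀ t x → π t ∋ x ≡ t ∋ α x
    π∋ = proj₂ ∘ preimage

    π-invol : ∀ t → π (π t) ≡ t
    π-invol t = ∋-injective λ x →
      trans (π∋ (π t) x) (trans (π∋ t (α x)) (cong (t ∋_) (invol x)))

  -- The prefix uses every letter, which makes the columns distinct; the padding by ∅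
  -- does not change their sizes.
  extend : ∀ {k} ρ → Vec (Fin M) k → Vec (Fin M) (M + (k + ρ))
  extend ρ w = Vec.allFin M ++ (w ++ Vec.replicate ρ ∅)

  extend-injective : ∀ {k} ρ {v w : Vec (Fin M) k} → extend ρ v ≡ extend ρ w → v ≡ w
  extend-injective ρ {v} {w} eq =
    Vec.++-injectiveˡ v w (Vec.++-injectiveʳ (Vec.allFin M) (Vec.allFin M) eq)

  -- Equal columns agree on the prefix, where every up-set occurs, so `x` and `y` belong to the same
  -- up-sets.
  extend-separates : ∀ {k} ρ (w : Vec (Fin M) k) → Injective _≡_ _≡_ (wordMap (extend ρ w))
  extend-separates ρ w {x} {y} eq = ∋-separates (tabulate-injective
    (trans (Vec.tabulate-∘ (_∋ x) id) (trans prefix (sym (Vec.tabulate-∘ (_∋ y) id)))))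
    where
    rest = w ++ Vec.replicate ρ ∅
    prefix : Vec.map (_∋ x) (Vec.allFin M) ≡ Vec.map (_∋ y) (Vec.allFin M)
    prefix = Vec.++-injectiveˡ (Vec.map (_∋ x) (Vec.allFin M)) _
      (trans (sym (Vec.map-++ (_∋ x) (Vec.allFin M) rest))
        (trans eq (Vec.map-++ (_∋ y) (Vec.allFin M) rest)))

  -- Every up-set occurs once in the prefix, which therefore adds `degree` to each column. This
  -- raises the balanced size `q * degree` to `suc q * degree`.
  ∣extend∣ : ∀ {k} ρ (w : Vec (Fin M) k) x →
    ∣ wordMap (extend ρ w) x ∣ ≡ degree (F.to x) + ∣ wordMap w x ∣
  ∣extend∣ ρ w x = begin
    ∣ wordMap (extend ρ w) x ∣
      ≡⟨ ∣column-++∣ (Vec.allFin M) _ e ⟩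
    ∣ wordMap (Vec.allFin M) x ∣ + ∣ wordMap (w ++ Vec.replicate ρ ∅) x ∣
      ≡⟨ cong₂ _+_ (trans (cong ∣_∣ (sym (Vec.tabulate-∘ (_∋ x) id))) (∣tabulate∣ (_∋ x)))
           (∣column-++∣ w (Vec.replicate ρ ∅) e) ⟩
    degree e + (∣ wordMap w x ∣ + ∣ wordMap (Vec.replicate ρ ∅) x ∣)
      ≡⟨ cong (λ A → degree e + (∣ wordMap w x ∣ + ∣ A ∣))
           (trans (Vec.map-replicate (_∋ x) ∅ ρ) (cong (Vec.replicate ρ) (∅-empty x))) ⟩
    degree e + (∣ wordMap w x ∣ + ∣ Sub.⊥ {ρ} ∣)
      ≡⟨ cong (degree e +_) (trans (cong (∣ wordMap w x ∣ +_) (Sub.∣⊥∣≡0 ρ)) (ℕ.+-identityʳ _)) ⟩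
    degree e + ∣ wordMap w x ∣ ∎
    where
    open ≡-Reasoning
    e = F.to x

  -- A profile has `M * size` entries, and the loss is taken once for each of the `M` blocks. The
  -- factors of `constant` pay for the prefix, the padding and the maps onto one copy.
  exponent constant : ℕ
  exponent = M * size * M
  constant = M ^ M * M ^ M * size ^ size

  -- The extended balanced words have all their columns in `𝓕`, so each spells a copy there, and
  -- `words≤copies` bounds their number.
  many-words : ∀ q ρ (𝓕 : Family (M + (M * q + ρ))) →
    (∀ A x → ∣ A ∣ ≡ suc q * degree (F.to x) → A ∈ᶠ 𝓕) →
    M ^ (M * q) ≤ (suc q ^ (M * size)) ^ M * (c P 𝓕 * size ^ size)
  many-words q ρ 𝓕 𝓕-full = ℕ.≤-trans words (ℕ.*-monoʳ-≤ ((suc q ^ (M * size)) ^ M) N≤)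
    where
    N = proj₁ (balanced q)
    words = proj₁ (proj₂ (balanced q))
    w = proj₁ (proj₂ (proj₂ (balanced q)))
    w-injective = proj₁ (proj₂ (proj₂ (proj₂ (balanced q))))
    w-size = proj₂ (proj₂ (proj₂ (proj₂ (balanced q))))

    column-size : ∀ i x → ∣ wordMap (extend ρ (w i)) x ∣ ≡ suc q * degree (F.to x)
    column-size i x = trans (∣extend∣ ρ (w i) x)
      (cong (degree (F.to x) +_) (w-size i (F.to x)))

    N≤ : N ≤ c P 𝓕 * size ^ size
    N≤ = words≤copies 𝓕 (extend ρ ∘ w)
      (λ {i} {j} eq → w-injective {i} {j} (extend-injective ρ {w i} {w j} eq))
      (λ i → extend-separates ρ (w i))
      (λ i x → 𝓕-full (wordMap (extend ρ (w i)) x) x (column-size i x))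

  -- Keeping `n` a variable with an equation lets matching on `refl` change the index of `Family n`
  -- without transporting `𝓕`.
  M^n≤-split : ∀ q ρ → ρ ≤ M → ∀ n → n ≡ M + (M * q + ρ) → suc q ≤ n → (𝓕 : Family n) →
    (∀ A x → ∣ A ∣ ≡ suc q * degree (F.to x) → A ∈ᶠ 𝓕) →
    M ^ n ≤ constant * (n ^ exponent * c P 𝓕)
  M^n≤-split q ρ ρ≤M n refl 1+q≤n 𝓕 𝓕-full =
    power-bound M q ρ (M * size) (c P 𝓕) (size ^ size) ρ≤M 1+q≤n (many-words q ρ 𝓕 𝓕-full)

  M^n≤ : ∀ n → M ≤ n → (𝓕 : Family n) →
    (∀ A x → ∣ A ∣ ≡ (n / M) * degree (F.to x) → A ∈ᶠ 𝓕) →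
    M ^ n ≤ constant * (n ^ exponent * c P 𝓕)
  M^n≤ n M≤n 𝓕 𝓕-full = go (n / M) refl (m≥n⇒m/n>0 M≤n)
    where
    ρ = n % M

    -- The quotient is positive because `M ≤ n`. Of its value `suc q`, one unit is spent on the
    -- prefix and `q` is left as the block length.
    go : ∀ k → n / M ≡ k → 0 < k → M ^ n ≤ constant * (n ^ exponent * c P 𝓕)
    go (suc q) n/M≡ _ = M^n≤-split q ρ (ℕ.<⇒≤ (m%n<n n M)) n n≡
      (subst (_≤ n) n/M≡ (m/n≤m n M)) 𝓕
      (λ A x ∣A∣≡ → 𝓕-full A x (trans ∣A∣≡ (cong (_* degree (F.to x)) (sym n/M≡))))
      where
      n≡ : n ≡ M + (M * q + ρ)
      n≡ = begin
        n                   ≡⟨ m≡m%n+[m/n]*n n M ⟩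
        ρ + (n / M) * M     ≡⟨ cong (λ k → ρ + k * M) n/M≡ ⟩
        ρ + (M + q * M)     ≡⟨ ℕ.+-comm ρ _ ⟩
        M + q * M + ρ       ≡⟨ ℕ.+-assoc M (q * M) ρ ⟩
        M + (q * M + ρ)     ≡⟨ cong (λ k → M + (k + ρ)) (ℕ.*-comm q M) ⟩
        M + (M * q + ρ)     ∎
        where open ≡-Reasoning

-- Unions of levels

⊆∧∣∣≥⇒≡ : ∀ {n} {A B : Subset n} → A ⊆ B → ∣ B ∣ ≤ ∣ A ∣ → A ≡ B
⊆∧∣∣≥⇒≡ {A = []}          {[]}          _   _   = refl
⊆∧∣∣≥⇒≡ {A = outside ∷ A} {outside ∷ B} A⊆B B≤A =
  cong (outside ∷_) (⊆∧∣∣≥⇒≡ (Sub.drop-∷-⊆ A⊆B) B≤A)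
⊆∧∣∣≥⇒≡ {A = outside ∷ A} {inside ∷ B}  A⊆B B≤A =
  contradiction (ℕ.≤-trans B≤A (Sub.p⊆q⇒∣p∣≤∣q∣ (Sub.drop-∷-⊆ A⊆B))) ℕ.1+n≰n
⊆∧∣∣≥⇒≡ {A = inside ∷ A}  {outside ∷ B} A⊆B _   = contradiction (A⊆B Vec.here) λ ()
⊆∧∣∣≥⇒≡ {A = inside ∷ A}  {inside ∷ B}  A⊆B B≤A =
  cong (inside ∷_) (⊆∧∣∣≥⇒≡ (Sub.drop-∷-⊆ A⊆B) (ℕ.≤-pred B≤A))

-- The values of `ℓ` may coincide or exceed `n`; the family then has fewer than `s` levels.
levels : ∀ {s} n → (Fin s → ℕ) → Family n
levels n ℓ = comprehension {n} (λ A → ∣ A ∣ ∈? tabulate ℓ)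

∈-levels : ∀ {s n} (ℓ : Fin s → ℕ) (A : Subset n) → A ∈ᶠ levels n ℓ ⇔ ∣ A ∣ ∈ˡ tabulate ℓ
∈-levels ℓ = ∈-comprehension (λ A → ∣ A ∣ ∈? tabulate ℓ)

-- Among the `suc s` members of a chain two share a level index, hence a size. Being nested they are
-- equal, against injectivity of the copy map.
levels-free : ∀ {s} n (ℓ : Fin s → ℕ) → Free (chain (suc s)) (levels n ℓ)
levels-free {s} n ℓ = cong length (filter-none
  (λ 𝓖 → (𝓖 ⊆ᶠ? levels n ℓ) ×-dec isCopy? (chain (suc s)) 𝓖)
  (All.universal noCopy (allFamilies n)))
  where
  noCopy : ∀ 𝓖 → ¬ (𝓖 ⊆ᶠ levels n ℓ × IsCopy (chain (suc s)) 𝓖)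
  noCopy 𝓖 (sub , φ , copy) =
    let a , b , a<b , same = Fin.pigeonhole ℕ.≤-refl (proj₁ ∘ level) in
    Fin.<⇒≢ a<b (IsCopyMap.injective copy (⊆∧∣∣≥⇒≡
      (IsCopyMap.monotone copy (ℕ.<⇒≤ a<b))
      (ℕ.≤-reflexive (trans (proj₂ (level b)) (trans (cong ℓ (sym same)) (sym (proj₂ (level a))))))))
    where
    level : ∀ a → ∃[ i ] ∣ φ a ∣ ≡ ℓ i
    level a = ∈-tabulate⁻ (Equivalence.to (∈-levels ℓ (φ a))
      (sub (φ a) (Equivalence.from (IsCopyMap.image copy (φ a)) (a , refl))))

-- Transpositions

module Transposition {A : Set} (_≟_ : DecidableEquality A) (x y : A) where

  swap : A → A
  swap z with z ≟ x | z ≟ y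
  ... | yes _ | _     = y
  ... | no _  | yes _ = x
  ... | no _  | no _  = z

  swap-x : swap x ≡ y
  swap-x with x ≟ x | x ≟ y
  ... | yes _  | _ = refl
  ... | no x≢x | _ = contradiction refl x≢x

  swap-y : swap y ≡ x
  swap-y with y ≟ x | y ≟ y
  ... | yes y≡x | _      = y≡x
  ... | no _    | yes _  = refl
  ... | no _    | no y≢y = contradiction refl y≢y

  swap-other : ∀ {z} → z ≢ x → z ≢ y → swap z ≡ z
  swap-other {z} z≢x z≢y with z ≟ x | z ≟ y
  ... | yes z≡x | _       = contradiction z≡x z≢x
  ... | no _    | yes z≡y = contradiction z≡y z≢y
  ... | no _    | no _    = refl

  swap-involutive : ∀ z → swap (swap z) ≡ z
  swap-involutive z with z ≟ x | z ≟ y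
  ... | yes refl | _        = swap-y
  ... | no _     | yes refl = swap-x
  ... | no z≢x   | no z≢y   = swap-other z≢x z≢y

  swap-preserves : ∀ {B : Set} (f : A → B) → f x ≡ f y → ∀ z → f (swap z) ≡ f z
  swap-preserves f fx≡fy z with z ≟ x | z ≟ y
  ... | yes refl | _        = sym fx≡fy
  ... | no _     | yes refl = fx≡fy
  ... | no _     | no _     = refl

-- Complete multi-level posets

module _ {s : ℕ} (r : Fin s → ℕ) where
  open FinPoset (K r) using (_≤ᴾ_; _≟ᴾ_; finite)
  open UpSets (K r) using (M; χ; La≤M^n)
  open LowerBound (K r)
  open Balanced χ using (degree)

  -- The strict order of `K r` depends on level indices alone, and exchanging two elements of one
  -- level preserves these. The exchange is thus a monotone involution.
  degree-level : ∀ i h h′ →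
    degree (Inverse.to finite (i , h)) ≡ degree (Inverse.to finite (i , h′))
  degree-level i h h′ = trans
    (degree-involution swap swap-monotone swap-involutive (i , h))
    (cong (degree ∘ Inverse.to finite) swap-x)
    where
    open Transposition _≟ᴾ_ (i , h) (i , h′)
    swap-monotone : ∀ x y → x ≤ᴾ y → swap x ≤ᴾ swap y
    swap-monotone x y (inj₁ x<y)  = inj₁ (subst₂ Fin._<_
      (sym (swap-preserves proj₁ refl x)) (sym (swap-preserves proj₁ refl y)) x<y)
    swap-monotone x y (inj₂ refl) = inj₂ refl

  module _ (r≥1 : ∀ i → 1 ≤ r i) where

    -- The first element of level `i`, present by `r≥1`, represents the level; by `degree-level` any
    -- other would give the same size.
    levelSize : ℕ → Fin s → ℕ
    levelSize n i = (n / M) * degree (Inverse.to finite (i , fromℕ< (r≥1 i)))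

    levelSize-full : ∀ n A x → ∣ A ∣ ≡ (n / M) * degree (Inverse.to finite x) →
      A ∈ᶠ levels n (levelSize n)
    levelSize-full n A (i , h) ∣A∣≡ = Equivalence.from (∈-levels (levelSize n) A)
      (subst (_∈ˡ tabulate (levelSize n))
        (sym (trans ∣A∣≡ (cong (n / M *_) (degree-level i h (fromℕ< (r≥1 i))))))
        (∈-tabulate⁺ i))

    -- The upper bound on `La` and the lower bound on the copies in the levels meet at `M ^ n`.
    La-bound : ∀ n → M ≤ n →
      La n (chain (suc s)) (K r) ≤ constant * (n ^ exponent * c (K r) (levels n (levelSize n)))
    La-bound n M≤n = ℕ.≤-trans (La≤M^n n (chain (suc s)))
      (M^n≤ n M≤n (levels n (levelSize n)) (levelSize-full n))

corollary1p11 : ∀ (s : ℕ) → 1 ≤ s → (r : Fin s → ℕ) → (∀ i → 1 ≤ r i) →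
    ∃[ k ] Σ[ 𝓕 ∈ (∀ n → Family n) ]
    (∀ n → Free (chain (suc s)) (𝓕 n) × UnionOfFullLevels (𝓕 n))
    × (λ n → La n (chain (suc s)) (K r)) =O (λ n → n ^ k * c (K r) (𝓕 n))
corollary1p11 s _ r r≥1 =
    LowerBound.exponent (K r)
  , 𝓕
  , (λ n → levels-free n (ℓ n) , tabulate (ℓ n) , ∈-levels (ℓ n))
  -- The threshold is the number of up-sets, because the words need room for the prefix.
  , LowerBound.constant (K r) , UpSets.M (K r) , La-bound r r≥1
  where
  ℓ = levelSize r r≥1

  𝓕 : ∀ n → Family n
  𝓕 n = levels n (ℓ n)
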